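{- Let $n, m \in \mathbb{N}$ and let $s_1, \dots, s_n$ be positive integers with $s_i \le 2^m$ for all $i$. Let $p_1 < \dots < p_q$ be all the distinct primes dividing at least one of the $s_i$, write $s_i = \prod_{k=1}^q p_k^{\alpha_{ik}}$ with $\alpha_{ik} \in \mathbb{Z}_{\ge 0}$, and let $S_M = (\alpha_{ik})_{1\le i\le n,\,1\le k\le q}$ be the $n \times q$ matrix of exponents. Then there exists a set $\mathcal{C} \subseteq \{1,\dots,n\}$ with $$\prod_{i \in \mathcal{C}} s_i = \prod_{i \in \{1,\dots,n\}\setminus \mathcal{C}} s_i$$ if and only if there exists $x \in \{0,1\}^n$ such that $$\left(x - \tfrac{1}{2}\, 1_{n\times 1}\right)^T S_M = 0_{1\times q}.$$
   Context: $\mathbb{N}$ denotes the positive integers. $1_{n\times 1}$ is the column vector of length $n$ with all entries $1$, and $0_{1\times q}$ is the zero row vector of length $q$. Empty products equal $1$. The first condition is the Product Partition Problem (PPP) for $s_1,\dots,s_n$. -}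

module Defs where

open import Data.Nat using (ℕ)
open import Data.Integer using (+_)
open import Data.Fin using (Fin)
open import Data.Fin.Subset using (Subset)
open import Data.Fin.Subset.Properties using (_∈?_)
open import Data.List using (map; filter; allFin; tabulate)
open import Data.Nat.ListAction using (product)
open import Data.Rational using (ℚ; 0ℚ; 1ℚ; _/_; _-_; _*_)
open import Data.Rational.Properties using (+-0-commutativeMonoid)
open import Data.Sum using (_⊎_)
open import Data.Vec.Functional using (Vector; replicate; zipWith)
open import Algebra.Properties.CommutativeMonoid.Sum +-0-commutativeMonoid using (sum)
open import Relation.Binary.PropositionalEquality using (_≡_)

∏ : ∀ {n} → Vector ℕ n → ℕ
∏ s = product (tabulate s)

∏∈ : ∀ {n} → Subset n → Vector ℕ n → ℕ
∏∈ {n} C s = product (map s (filter (_∈? C) (allFin n)))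

Matrix : Set → ℕ → ℕ → Set
Matrix A n q = Fin n → Fin q → A

fromℕ : ℕ → ℚ
fromℕ a = + a / 1

-- The condition x ∈ {0,1}ⁿ, with 0 and 1 taken in ℚ so that x - ½·1 makes sense.
Binary : ∀ {n} → Vector ℚ n → Set
Binary x = ∀ i → x i ≡ 0ℚ ⊎ x i ≡ 1ℚ

infixl 6 _-ᵛ_
infixr 7 _·ᵛ_
infixl 7 _ᵀ*_

_-ᵛ_ : ∀ {n} → Vector ℚ n → Vector ℚ n → Vector ℚ n
_-ᵛ_ = zipWith _-_

_·ᵛ_ : ∀ {n} → ℚ → Vector ℚ n → Vector ℚ n
(c ·ᵛ v) i = c * v i

-- v ᵀ* M is the row vector vᵀ M; the natural-number entries of M
-- are read as rationals.
_ᵀ*_ : ∀ {n q} → Vector ℚ n → Matrix ℕ n q → Vector ℚ q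
(v ᵀ* M) k = sum (λ i → v i * fromℕ (M i k))

ones zeros : ∀ n → Vector ℚ n
ones n = replicate n 1ℚ
zeros n = replicate n 0ℚ

-- By unique factorization the product equation for C says that, for every k, the exponents of
-- p k over C and over its complement have equal sums A k = B k. If x is the indicator vector
-- of C, the entries of x - ½ are ½ on C and -½ off C, so the k-th entry of (x - ½)ᵀ S_M is
-- ½ (A k - B k), and it vanishes for the same k.
module Submission where

open import Defs
import Algebra.Properties.AbelianGroup as AbelianGroupProperties
import Algebra.Properties.CommutativeMonoid.Sum as Sum
open import Data.Bool using (Bool; true; false; not; if_then_else_)
open import Data.Nat using (ℕ; zero; suc; NonZero; nonTrivial⇒≢1; _+_; _*_; _^_; _≤_; _<_)
import Data.Nat.Properties as ℕ
open import Data.Nat.Divisibility using (_∣_; _∤_; m∣m*n; ∣1⇒≡1)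
open import Data.Nat.ListAction using (product)
open import Data.Nat.Primality using (Prime; euclidsLemma; prime⇒nonZero; prime⇒nonTrivial; prime⇒irreducible)
open import Data.Fin as Fin using (Fin; zero; suc)
import Data.Fin.Properties as Fin
open import Data.Fin.Subset using (Subset; ∁)
open import Data.Fin.Subset.Properties using (_∈?_)
import Data.Integer as ℤ
import Data.Integer.Properties as ℤ
open import Data.List as List using (filter)
open import Data.Product using (∃; ∃-syntax; _×_; _,_; proj₁; proj₂)
open import Data.Rational as ℚ using (ℚ; 0ℚ; 1ℚ; ½)
import Data.Rational.Properties as ℚ
open import Data.Rational.Solver using (module +-*-Solver)
import Data.Rational.Unnormalised as ℚᵘ
import Data.Rational.Unnormalised.Properties as ℚᵘ
open import Data.Sum using (_⊎_; inj₁; inj₂)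
open import Data.Vec as Vec using (_∷_; lookup)
open import Data.Vec.Properties using (lookup∘tabulate)
open import Data.Vec.Functional using (Vector)
open import Function using (_∘_)
open import Function.Bundles using (_⇔_; mk⇔; Equivalence)
open import Function.Definitions using (Injective)
open import Relation.Binary.Definitions using (tri<; tri≈; tri>)
open import Relation.Binary.PropositionalEquality
  using (_≡_; _≢_; _≗_; refl; sym; trans; cong; cong₂; subst; module ≡-Reasoning)
open import Relation.Nullary using (does; yes; no; contradiction)
open import Relation.Unary using (Decidable)

module ∑ = Sum ℕ.+-0-commutativeMonoid
-- Sums over the multiplicative monoid: ∏′.sum is a product.
module ∏′ = Sum ℕ.*-1-commutativeMonoid
module ∑ℚ = Sum ℚ.+-0-commutativeMonoid

private
  variable
    n q : ℕ

∏≡∏′ : (f : Vector ℕ n) → ∏ f ≡ ∏′.sum f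
∏≡∏′ {zero}  f = refl
∏≡∏′ {suc n} f = cong (f zero *_) (∏≡∏′ (f ∘ suc))

prime∤1 : ∀ {r} → Prime r → r ∤ 1
prime∤1 pr r∣1 = contradiction (∣1⇒≡1 r∣1) (nonTrivial⇒≢1 {{prime⇒nonTrivial pr}})

-- Euclid's lemma brings `r` down to a divisor of `p` itself, and `p` is irreducible.
prime∣^⇒≡ : ∀ {r p} a → Prime r → Prime p → r ∣ p ^ a → r ≡ p
prime∣^⇒≡ zero pr pp r∣1 = contradiction r∣1 (prime∤1 pr)
prime∣^⇒≡ {p = p} (suc a) pr pp r∣ with euclidsLemma p (p ^ a) pr r∣
... | inj₂ r∣p^a = prime∣^⇒≡ a pr pp r∣p^a
... | inj₁ r∣p with prime⇒irreducible pp r∣p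
...   | inj₁ r≡1 = contradiction r≡1 (nonTrivial⇒≢1 {{prime⇒nonTrivial pr}})
...   | inj₂ r≡p = r≡p

prime∤∏^ : ∀ {r} {p : Vector ℕ q} → Prime r → (∀ k → Prime (p k)) → (∀ k → r ≢ p k) →
           (a : Vector ℕ q) → r ∤ ∏′.sum (λ k → p k ^ a k)
prime∤∏^ {zero}  pr pp r≢p a r∣1 = contradiction r∣1 (prime∤1 pr)
prime∤∏^ {suc q} pr pp r≢p a r∣ with euclidsLemma _ _ pr r∣
... | inj₁ r∣h = r≢p zero (prime∣^⇒≡ (a zero) pr (pp zero) r∣h)
... | inj₂ r∣t = prime∤∏^ pr (pp ∘ suc) (r≢p ∘ suc) (a ∘ suc) r∣t

-- The exponent is the `p`-adic valuation of the common value. Factors `p` are cancelled in pairs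
-- until one exponent is zero; a positive exponent left on the other side would make `p` divide `x`
-- or `y`.
^*-injective : ∀ {p x y} .{{_ : NonZero p}} → p ∤ x → p ∤ y →
               ∀ a b → p ^ a * x ≡ p ^ b * y → a ≡ b × x ≡ y
^*-injective {p} {x} {y} p∤x p∤y zero    zero    eq =
  refl , ℕ.*-cancelˡ-≡ x y 1 eq
^*-injective {p} {x} {y} p∤x p∤y zero    (suc b) eq = contradiction
  (subst (p ∣_) (trans (sym (trans eq (ℕ.*-assoc p (p ^ b) y))) (ℕ.*-identityˡ x)) (m∣m*n (p ^ b * y)))
  p∤x
^*-injective {p} {x} {y} p∤x p∤y (suc a) zero    eq = contradiction
  (subst (p ∣_) (trans (sym (ℕ.*-assoc p (p ^ a) x)) (trans eq (ℕ.*-identityˡ y))) (m∣m*n (p ^ a * x)))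
  p∤y
^*-injective {p} {x} {y} p∤x p∤y (suc a) (suc b) eq
  with refl , x≡y ← ^*-injective {p} {x} {y} p∤x p∤y a b
    (ℕ.*-cancelˡ-≡ _ _ p (trans (sym (ℕ.*-assoc p (p ^ a) x)) (trans eq (ℕ.*-assoc p (p ^ b) y))))
  = refl , x≡y

-- Uniqueness of prime factorization. The first prime does not divide the product over the others,
-- so `^*-injective` splits off its exponent and leaves an equation between the remaining products.
∏^-injective : {p : Vector ℕ q} → (∀ k → Prime (p k)) → Injective _≡_ _≡_ p →
               (a b : Vector ℕ q) →
               ∏′.sum (λ k → p k ^ a k) ≡ ∏′.sum (λ k → p k ^ b k) → a ≗ b
∏^-injective {suc q} {p} pp inj a b eq = λ where
    zero    → proj₁ split
    (suc k) → ∏^-injective (pp ∘ suc) (Fin.suc-injective ∘ inj) (a ∘ suc) (b ∘ suc) (proj₂ split) k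
  where
  p₀≢ : ∀ k → p zero ≢ p (suc k)
  p₀≢ k e = contradiction (inj e) λ ()
  p₀∤ = prime∤∏^ (pp zero) (pp ∘ suc) p₀≢
  split = ^*-injective {{prime⇒nonZero (pp zero)}}
            (p₀∤ (a ∘ suc)) (p₀∤ (b ∘ suc)) (a zero) (b zero) eq

∏^≡^∑ : ∀ p (a : Vector ℕ n) → ∏′.sum (λ i → p ^ a i) ≡ p ^ ∑.sum a
∏^≡^∑ {zero}  p a = refl
∏^≡^∑ {suc n} p a = trans (cong (p ^ a zero *_) (∏^≡^∑ p (a ∘ suc)))
                          (sym (ℕ.^-distribˡ-+-* p (a zero) _))

strictlyIncreasing⇒injective : {p : Vector ℕ q} → (∀ j k → j Fin.< k → p j < p k) →
                               Injective _≡_ _≡_ p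
strictlyIncreasing⇒injective mono {j} {k} eq with Fin.<-cmp j k
... | tri< j<k _ _ = contradiction eq (ℕ.<⇒≢ (mono j k j<k))
... | tri≈ _ j≡k _ = j≡k
... | tri> _ _ k<j = contradiction (sym eq) (ℕ.<⇒≢ (mono k j k<j))

-- Putting the neutral factor 1 for each dropped index makes the index set independent of the
-- subset, so products can later be interchanged. A general `f` replaces `allFin` because the
-- induction passes to `f ∘ suc`.
product-filter-tabulate : ∀ {A : Set} {P : A → Set} (P? : Decidable P) (s : A → ℕ) (f : Fin n → A) →
  product (List.map s (filter P? (List.tabulate f))) ≡
  ∏′.sum (λ i → if does (P? (f i)) then s (f i) else 1)
product-filter-tabulate {zero}  P? s f = refl
product-filter-tabulate {suc n} P? s f with P? (f zero)
... | yes _ = cong (s (f zero) *_) (product-filter-tabulate P? s (f ∘ suc))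
... | no  _ = trans (product-filter-tabulate P? s (f ∘ suc)) (sym (ℕ.*-identityˡ _))

does-∈? : (i : Fin n) (C : Subset n) → does (i ∈? C) ≡ lookup C i
does-∈? zero    (true  ∷ C) = refl
does-∈? zero    (false ∷ C) = refl
does-∈? (suc i) (_ ∷ C)     = does-∈? i C

exponentSum : Subset n → Vector ℕ n → ℕ
exponentSum C a = ∑.sum (λ i → if lookup C i then a i else 0)

-- Interchanging the products over `i` and `k` collects all powers of one prime, whose exponents
-- then add up.
∏∈-factored : ∀ {p : Vector ℕ q} {s : Vector ℕ n} {S : Matrix ℕ n q} →
              (∀ i → s i ≡ ∏ (λ k → p k ^ S i k)) → ∀ C →
              ∏∈ C s ≡ ∏′.sum (λ k → p k ^ exponentSum C (λ i → S i k))
∏∈-factored {q = q} {n = n} {p} {s} {S} s≡ C = begin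
  ∏∈ C s
    ≡⟨ product-filter-tabulate (_∈? C) s (λ i → i) ⟩
  ∏′.sum (λ i → if does (i ∈? C) then s i else 1)
    ≡⟨ ∏′.sum-cong-≗ (λ i → trans (cong (if_then s i else 1) (does-∈? i C)) (entry i (lookup C i))) ⟩
  ∏′.sum (λ i → ∏′.sum (λ k → p k ^ (if lookup C i then S i k else 0)))
    ≡⟨ ∏′.∑-comm {n} {q} (λ i k → p k ^ (if lookup C i then S i k else 0)) ⟩
  ∏′.sum (λ k → ∏′.sum (λ i → p k ^ (if lookup C i then S i k else 0)))
    ≡⟨ ∏′.sum-cong-≗ (λ k → ∏^≡^∑ (p k) (λ i → if lookup C i then S i k else 0)) ⟩
  ∏′.sum (λ k → p k ^ exponentSum C (λ i → S i k)) ∎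
  where
  open ≡-Reasoning
  entry : ∀ i b → (if b then s i else 1) ≡ ∏′.sum (λ k → p k ^ (if b then S i k else 0))
  entry i true  = trans (s≡ i) (∏≡∏′ (λ k → p k ^ S i k))
  entry i false = sym (∏′.sum-replicate-zero q)

fromℕ-injective : ∀ {a b} → fromℕ a ≡ fromℕ b → a ≡ b
fromℕ-injective {a} {b} eq
  -- `mkℚᵘ` stores the denominator minus one, so 0 encodes denominator 1, and `e` is the
  -- cross-multiplied equation.
  with ℚᵘ.*≡* e ← ℚ.fromℚᵘ-injective {ℚᵘ.mkℚᵘ (ℤ.+ a) 0} {ℚᵘ.mkℚᵘ (ℤ.+ b) 0} eq =
  ℤ.+-injective (trans (sym (ℤ.*-identityʳ (ℤ.+ a))) (trans e (ℤ.*-identityʳ (ℤ.+ b))))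

-- Rational arithmetic normalises by a gcd that does not reduce for variables, so the identity is
-- checked on unnormalised fractions.
fromℕ-homo-+ : ∀ a b → fromℕ (a + b) ≡ fromℕ a ℚ.+ fromℕ b
fromℕ-homo-+ a b = ℚ.toℚᵘ-injective (begin
  ℚ.toℚᵘ (fromℕ (a + b))
    ≈⟨ ℚ.toℚᵘ-fromℚᵘ (ℚᵘ.mkℚᵘ (ℤ.+ (a + b)) 0) ⟩
  ℚᵘ.mkℚᵘ (ℤ.+ (a + b)) 0
    ≈⟨ ℚᵘ.*≡* (cong (ℤ._* ℤ.+ 1) (cong₂ ℤ._+_ (sym (ℤ.*-identityʳ (ℤ.+ a))) (sym (ℤ.*-identityʳ (ℤ.+ b))))) ⟩
  ℚᵘ.mkℚᵘ (ℤ.+ a) 0 ℚᵘ.+ ℚᵘ.mkℚᵘ (ℤ.+ b) 0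
    ≈⟨ ℚᵘ.+-cong (ℚ.toℚᵘ-fromℚᵘ (ℚᵘ.mkℚᵘ (ℤ.+ a) 0)) (ℚ.toℚᵘ-fromℚᵘ (ℚᵘ.mkℚᵘ (ℤ.+ b) 0)) ⟨
  ℚ.toℚᵘ (fromℕ a) ℚᵘ.+ ℚ.toℚᵘ (fromℕ b)
    ≈⟨ ℚ.toℚᵘ-homo-+ (fromℕ a) (fromℕ b) ⟨
  ℚ.toℚᵘ (fromℕ a ℚ.+ fromℕ b) ∎)
  where open import Relation.Binary.Reasoning.Setoid ℚᵘ.≃-setoid

indicator : Subset n → Vector ℚ n
indicator C i = if lookup C i then 1ℚ else 0ℚ

-- Only pointwise agreement of `x` with the indicator is assumed, since without function
-- extensionality a binary vector yields no more than that.
∑-centred-indicator : (C : Subset n) {x : Vector ℚ n} → x ≗ indicator C → (a : Vector ℕ n) →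
  ∑ℚ.sum (λ i → (x i ℚ.- ½ ℚ.* 1ℚ) ℚ.* fromℕ (a i)) ≡
  ½ ℚ.* (fromℕ (exponentSum C a) ℚ.- fromℕ (exponentSum (∁ C) a))
∑-centred-indicator Vec.[] x≗ a = refl
∑-centred-indicator (c ∷ C) {x} x≗ a = begin
  (x zero ℚ.- ½ ℚ.* 1ℚ) ℚ.* fromℕ (a zero) ℚ.+
    ∑ℚ.sum (λ i → (x (suc i) ℚ.- ½ ℚ.* 1ℚ) ℚ.* fromℕ (a (suc i)))
    ≡⟨ cong₂ ℚ._+_ (cong (λ y → (y ℚ.- ½ ℚ.* 1ℚ) ℚ.* fromℕ (a zero)) (x≗ zero))
                   (∑-centred-indicator C (x≗ ∘ suc) (a ∘ suc)) ⟩
  ((if c then 1ℚ else 0ℚ) ℚ.- ½ ℚ.* 1ℚ) ℚ.* fromℕ (a zero) ℚ.+ ½ ℚ.* (fromℕ A ℚ.- fromℕ B)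
    ≡⟨ head c (a zero) (fromℕ A) (fromℕ B) ⟩
  ½ ℚ.* ((fromℕ (if c then a zero else 0) ℚ.+ fromℕ A) ℚ.-
         (fromℕ (if not c then a zero else 0) ℚ.+ fromℕ B))
    ≡⟨ cong (½ ℚ.*_) (cong₂ ℚ._-_ (fromℕ-homo-+ (if c then a zero else 0) A)
                                  (fromℕ-homo-+ (if not c then a zero else 0) B)) ⟨
  ½ ℚ.* (fromℕ (exponentSum (c ∷ C) a) ℚ.- fromℕ (exponentSum (∁ (c ∷ C)) a)) ∎
  where
  open ≡-Reasoning
  open +-*-Solver using (solve; con; _:+_; _:*_; _:-_; _:=_)
  A B : ℕ
  A = exponentSum C (a ∘ suc)
  B = exponentSum (∁ C) (a ∘ suc)
  -- Splitting on `c` evaluates the conditionals and leaves a ring identity; `con 0ℚ` is the masked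
  -- entry `fromℕ 0`.
  head : ∀ c z A B →
    ((if c then 1ℚ else 0ℚ) ℚ.- ½ ℚ.* 1ℚ) ℚ.* fromℕ z ℚ.+ ½ ℚ.* (A ℚ.- B) ≡
    ½ ℚ.* ((fromℕ (if c then z else 0) ℚ.+ A) ℚ.- (fromℕ (if not c then z else 0) ℚ.+ B))
  head true  z = solve 3 (λ z A B →
    (con 1ℚ :- con ½ :* con 1ℚ) :* z :+ con ½ :* (A :- B) :=
    con ½ :* ((z :+ A) :- (con 0ℚ :+ B))) refl (fromℕ z)
  head false z = solve 3 (λ z A B →
    (con 0ℚ :- con ½ :* con 1ℚ) :* z :+ con ½ :* (A :- B) :=
    con ½ :* ((con 0ℚ :+ A) :- (z :+ B))) refl (fromℕ z)

½*[a-b]≡0⇔a≡b : ∀ a b → ½ ℚ.* (fromℕ a ℚ.- fromℕ b) ≡ 0ℚ ⇔ a ≡ b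
½*[a-b]≡0⇔a≡b a b = mk⇔
  (λ eq → fromℕ-injective (x∙y⁻¹≈ε⇒x≈y (fromℕ a) (fromℕ b)
    (½*y≡0⇒y≡0 _ eq)))
  (λ a≡b → cong (½ ℚ.*_) (x≈y⇒x∙y⁻¹≈ε (cong fromℕ a≡b)))
  where
  open AbelianGroupProperties ℚ.+-0-abelianGroup
  ½*y≡0⇒y≡0 : ∀ y → ½ ℚ.* y ≡ 0ℚ → y ≡ 0ℚ
  -- Writing `y` as the sum of its two halves avoids any division.
  ½*y≡0⇒y≡0 y eq = trans (solve 1 (λ y → y := (con ½ :* y) :+ (con ½ :* y)) refl y)
                         (cong₂ ℚ._+_ eq eq)
    where open +-*-Solver

-- Fixing `C` and `x` together leaves only a comparison of the exponent vectors `A` and `B`: unique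
-- factorization turns equal products into equal exponents, and congruence goes back.
partition⇔balanced :
  {s : Vector ℕ n} {p : Vector ℕ q} {S : Matrix ℕ n q} →
  (∀ k → Prime (p k)) → Injective _≡_ _≡_ p →
  (∀ i → s i ≡ ∏ (λ k → p k ^ S i k)) →
  (C : Subset n) {x : Vector ℚ n} → x ≗ indicator C →
  ∏∈ C s ≡ ∏∈ (∁ C) s ⇔ (x -ᵛ ½ ·ᵛ ones n) ᵀ* S ≗ zeros q
partition⇔balanced {s = s} {p} {S} pp inj s≡ C {x} x≗ = mk⇔
  (λ eq k → trans (entry k) (from (½*[a-b]≡0⇔a≡b (A k) (B k))
    (∏^-injective pp inj A B (trans (sym ∏C) (trans eq ∏∁C)) k)))
  (λ eq → trans ∏C (trans
    (∏′.sum-cong-≗ (λ k → cong (p k ^_)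
      (to (½*[a-b]≡0⇔a≡b (A k) (B k)) (trans (sym (entry k)) (eq k)))))
    (sym ∏∁C)))
  where
  open Equivalence
  A B : Vector ℕ _
  A k = exponentSum C (λ i → S i k)
  B k = exponentSum (∁ C) (λ i → S i k)
  ∏C : ∏∈ C s ≡ ∏′.sum (λ k → p k ^ A k)
  ∏C = ∏∈-factored {p = p} {S = S} s≡ C
  ∏∁C : ∏∈ (∁ C) s ≡ ∏′.sum (λ k → p k ^ B k)
  ∏∁C = ∏∈-factored {p = p} {S = S} s≡ (∁ C)
  entry : ∀ k → ((x -ᵛ ½ ·ᵛ ones _) ᵀ* S) k ≡ ½ ℚ.* (fromℕ (A k) ℚ.- fromℕ (B k))
  entry k = ∑-centred-indicator C x≗ (λ i → S i k)

indicator-binary : (C : Subset n) → Binary (indicator C)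
indicator-binary C i with lookup C i
... | true  = inj₂ refl
... | false = inj₁ refl

-- The subset is read off from which disjunct the proof of `Binary x` supplies at each index, so no
-- rational has to be compared.
binary⇒indicator : {x : Vector ℚ n} → Binary x → ∃ λ (C : Subset n) → x ≗ indicator C
binary⇒indicator bin = Vec.tabulate (λ i → side (bin i)) , λ i →
  trans (value (bin i)) (cong (if_then 1ℚ else 0ℚ) (sym (lookup∘tabulate (λ i → side (bin i)) i)))
  where
  side : ∀ {y} → y ≡ 0ℚ ⊎ y ≡ 1ℚ → Bool
  side (inj₁ _) = false
  side (inj₂ _) = true
  value : ∀ {y} (d : y ≡ 0ℚ ⊎ y ≡ 1ℚ) → y ≡ (if side d then 1ℚ else 0ℚ)
  value (inj₁ e) = e
  value (inj₂ e) = e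

lemma2p2 :
  (n m : ℕ) → .{{_ : NonZero n}} → .{{_ : NonZero m}} →
  (s : Vector ℕ n) →
  (∀ i → 0 < s i) →
  (∀ i → s i ≤ 2 ^ m) →
  (q : ℕ) (p : Vector ℕ q) →
  (∀ (j k : Fin q) → j Fin.< k → p j < p k) →
  (∀ (r : ℕ) → (∃[ k ] p k ≡ r) ⇔ (Prime r × (∃[ i ] r ∣ s i))) →
  (S_M : Matrix ℕ n q) →
  (∀ i → s i ≡ ∏ (λ k → p k ^ S_M i k)) →
  (∃ λ (C : Subset n) → ∏∈ C s ≡ ∏∈ (∁ C) s)
    ⇔
  (∃ λ (x : Vector ℚ n) → Binary x × (x -ᵛ ½ ·ᵛ ones n) ᵀ* S_M ≗ zeros q)
lemma2p2 n m s _ _ q p p-mono p-primes S s≡ = mk⇔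
  (λ (C , eq) → indicator C , indicator-binary C , to (main C (λ _ → refl)) eq)
  (λ (x , bin , eq) → let C , x≗ = binary⇒indicator bin in C , from (main C x≗) eq)
  where
  open Equivalence
  -- Each `p k` is prime by the characterization of the listed primes at `r = p k`; strict increase
  -- makes them distinct.
  main = partition⇔balanced {S = S} (λ k → proj₁ (to (p-primes (p k)) (k , refl)))
           (strictlyIncreasing⇒injective p-mono) s≡
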